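{- Let $p\neq 5$ be a prime. Then for every residue class $m\in\mathbf{Z}_p^*$ there exist an integer $t\ge 2$ and integers $x_1,\dots,x_t\ge 1$ with $x_1+\cdots+x_t=p$ such that $x_1!\,x_2!\cdots x_t!\equiv m \pmod p$. That is, $\bigcup_{t\ge 2}P_{p,t}(p)=\mathbf{Z}_p^*$.
   Context: For a prime $p$ and positive integers $s,t$, $P_{s,t}(p)=\{x_1!\,x_2!\cdots x_t! \pmod p \;:\; x_i\ge 1,\ \sum_{i=1}^t x_i=s\}$. $\mathbf{Z}_p^*$ denotes the set of nonzero residue classes modulo $p$. (Equivalently, the numbers $\frac{1}{p}\binom{p}{m_1,\dots,m_t}$ with $t\ge 2$, $m_i\ge1$, $\sum m_i=p$, cover all of $\mathbf{Z}_p^*$ modulo $p$.) -}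

module Defs where

open import Data.Nat using (ℕ; _!; _≤_; _%_; NonZero)
open import Data.List using (List; length; map)
open import Data.Nat.ListAction using (sum; product)
open import Data.List.Relation.Unary.All using (All)
open import Data.Product using (_×_)
open import Relation.Binary.PropositionalEquality using (_≡_)

IsComposition : ℕ → ℕ → List ℕ → Set
IsComposition s t xs = length xs ≡ t × All (1 ≤_) xs × sum xs ≡ s

factProd : List ℕ → ℕ
factProd xs = product (map _! xs)

{-# OPTIONS --safe #-}

-- Call c the cost of a product of factorials x₁! ⋯ xₜ! with Σ xᵢ = c; parts
-- equal to 1 are free padding.  We exhibit subgroups H of Z_p^* all of whose
-- elements have cost at most |H| + 1, ending with H = Z_p^*, where the bound
-- is p.
--
-- Start: H = ⟨2, 6⟩ with 2! = 2 and 3! = 6.  Let f be the order of 2 and d the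
-- index of ⟨2⟩ in H.  If d ≥ 2, the elements 2^i 6^j (i < f, j < d) cost at
-- most 2(f-1) + 3(d-1) ≤ fd + 1.  If d = 1, write 6 = 2^k; an exponent e < f is
-- handled by 2^e when 2e ≤ f + 1, by dividing e by k when e ≥ k, and otherwise
-- by dividing f - e by f - k, which fails only for 12 = 1, that is p = 11.
--
-- Step: if 1, …, n ∈ H but n + 1 ∉ H, then 2n < p, so 1, …, n, 2n are distinct
-- elements of H and |H| ≥ n + 1.  Adjoining (n+1)!, of relative order d, adds
-- at most (n+1)(d-1) ≤ |H|(d-1) to the cost.
module Submission where

open import Defs
open import Data.Nat using (ℕ; zero; suc; _+_; _*_; _∸_; _^_; _!; _/_; _≤_; _<_; _≤?_; _%_; z≤n; s≤s; NonZero; nonTrivial⇒n>1)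
import Data.Nat as ℕ
open import Data.Nat.Properties
open import Data.Nat.DivMod hiding (_mod_)
open import Data.Nat.Divisibility
open import Data.Nat.ListAction using (sum; product)
open import Data.Nat.ListAction.Properties using (sum-++; product-++)
open import Data.Nat.Primality using (Prime; prime?; euclidsLemma; prime⇒irreducible; prime⇒nonTrivial)
open import Data.Nat.Tactic.RingSolver using (solve-∀)
open import Data.Fin using (Fin; zero; suc; toℕ; fromℕ<; combine; remQuot)
open import Data.Fin.Properties using (pigeonhole; any?; toℕ<n; toℕ-injective; toℕ-fromℕ<; fromℕ<-injective; remQuot-combine; combine-remQuot)
open import Data.List using (List; []; _∷_; _++_; map; length)
open import Data.List.Properties using (map-++)
open import Data.List.Relation.Unary.All using (All; []; _∷_; all?)
open import Data.List.Relation.Unary.All.Properties using (++⁺)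
open import Data.Product using (Σ; ∃; ∃₂; _×_; _,_; proj₁; proj₂)
open import Data.Sum using (inj₁; inj₂; [_,_]′)
open import Function using (_∘_)
open import Relation.Binary.Bundles using (Setoid)
open import Relation.Binary.Definitions using (tri<; tri≈; tri>)
open import Relation.Binary.PropositionalEquality using (_≡_; _≢_; refl; sym; trans; cong; cong₂; subst; module ≡-Reasoning)
import Relation.Binary.Reasoning.Setoid as SetoidReasoning
open import Relation.Nullary using (¬_; Dec; yes; no; contradiction)
open import Relation.Nullary.Decidable using (True; toWitness)
import Relation.Nullary.Decidable as Dec
open import Relation.Unary using (Pred; Decidable)

-- Least witnesses and the inequalities behind the cost bounds.

least : ∀ {ℓ} {P : Pred ℕ ℓ} → Decidable P → ∀ n → P n →
        ∃ λ m → P m × (∀ j → j < m → ¬ P j)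
least P? n Pn with P? 0
... | yes P0 = 0 , P0 , λ _ ()
least P? zero P0 | no ¬P0 = contradiction P0 ¬P0
least P? (suc n) Pn | no ¬P0 with least (P? ∘ suc) n Pn
... | m , Pm , min = suc m , Pm , λ { zero _ → ¬P0 ; (suc j) (s≤s j<m) → min j j<m }

≤suc-elim : ∀ {ℓ n} {P : Pred ℕ ℓ} → (∀ k → 1 ≤ k → k ≤ n → P k) → P (suc n) →
            ∀ k → 1 ≤ k → k ≤ suc n → P k
≤suc-elim all Pn k 1≤k k≤ with m≤n⇒m<n∨m≡n k≤
... | inj₁ (s≤s k≤n) = all k 1≤k k≤n
... | inj₂ refl      = Pn

prime∣prime⇒≡ : ∀ {p q} → Prime p → Prime q → p ∣ q → p ≡ q
prime∣prime⇒≡ {p} pp pq p∣q with prime⇒irreducible pq p∣q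
... | inj₂ p≡q = p≡q
... | inj₁ refl = contradiction (nonTrivial⇒n>1 1 {{prime⇒nonTrivial pp}}) λ { (s≤s ()) }

-- For a relative order D = `suc d` and an order F = `suc f`, the slack at the extreme exponents is
-- exactly (F - 3)(D - 2).
two-generator-cost : ∀ {i j f d} → 3 ≤ suc f → 2 ≤ suc d → i ≤ f → j ≤ d →
                     i * 2 + j * 3 ≤ suc (suc d * suc f)
two-generator-cost {f = zero} (s≤s ())
two-generator-cost {f = suc zero} (s≤s (s≤s ()))
two-generator-cost {f = suc (suc _)} {zero} _ (s≤s ())
two-generator-cost {i} {j} {suc (suc x)} {suc y} _ _ i≤ j≤ = begin
  i * 2 + j * 3                       ≤⟨ +-mono-≤ (*-monoˡ-≤ 2 i≤) (*-monoˡ-≤ 3 j≤) ⟩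
  (2 + x) * 2 + (1 + y) * 3           ≤⟨ m≤m+n _ (x * y) ⟩
  (2 + x) * 2 + (1 + y) * 3 + x * y   ≡⟨ expand x y ⟩
  suc ((2 + y) * (3 + x))             ∎
  where
  open ≤-Reasoning
  expand : ∀ x y → (2 + x) * 2 + (1 + y) * 3 + x * y ≡ suc ((2 + y) * (3 + x))
  expand = solve-∀

-- Prices 2^e as 2^r 6^(c+1), where 6 = 2^k and e = k + r + ck. The budget is e + 2, and the slack
-- is (k - 1 - r) + c(k - 3).
positive-exponent-cost : ∀ r c k → 3 ≤ k → r < k →
                         r * 2 + suc c * 3 ≤ 2 + (k + (r + c * k))
positive-exponent-cost _ _ 0 () _
positive-exponent-cost _ _ 1 (s≤s ()) _
positive-exponent-cost _ _ 2 (s≤s (s≤s ())) _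
positive-exponent-cost r c (suc (suc (suc x))) _ (s≤s r≤) with m≤n⇒∃[o]m+o≡n r≤
... | z , r+z≡ = begin
  r * 2 + suc c * 3                     ≤⟨ m≤m+n _ (z + c * x) ⟩
  r * 2 + suc c * 3 + (z + c * x)       ≡⟨ expand r c z x ⟩
  (r + z) + (3 + (r + c * (3 + x)))     ≡⟨ cong (_+ (3 + (r + c * (3 + x)))) r+z≡ ⟩
  (2 + x) + (3 + (r + c * (3 + x)))     ≡⟨ regroup x (r + c * (3 + x)) ⟩
  2 + ((3 + x) + (r + c * (3 + x)))     ∎
  where
  open ≤-Reasoning
  expand : ∀ r c z x → r * 2 + suc c * 3 + (z + c * x) ≡ (r + z) + (3 + (r + c * (3 + x)))
  expand = solve-∀
  regroup : ∀ x u → (2 + x) + (3 + u) ≡ 2 + ((3 + x) + u)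
  regroup = solve-∀

-- Prices 2^e as 2^z 6^(y+2) when 6 is read as 2^(-l). Here f - e = l + 1 + s + yl, and adding z
-- rounds it up to (y + 2)l; the last hypothesis says 2 + 2(f - e) ≤ f.
negative-exponent-cost : ∀ s z y {f} l → 2 ≤ l → suc s + z ≡ l →
                         2 + 2 * (l + suc (s + y * l)) ≤ f →
                         z * 2 + (2 + y) * 3 ≤ suc f
negative-exponent-cost _ _ _ 0 () _ _
negative-exponent-cost _ _ _ 1 (s≤s ()) _ _
negative-exponent-cost s z y {f} (suc (suc x)) _ s+z≡l bound = begin
  z * 2 + (2 + y) * 3                                   ≤⟨ m≤m+n _ (1 + y + 4 * s + y * x * 2) ⟩
  z * 2 + (2 + y) * 3 + (1 + y + 4 * s + y * x * 2)     ≡⟨ expand s z y x ⟩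
  2 * (suc s + z) + (5 + 2 * (s + y * (2 + x)))         ≡⟨ cong (λ w → 2 * w + (5 + 2 * (s + y * (2 + x)))) s+z≡l ⟩
  2 * (2 + x) + (5 + 2 * (s + y * (2 + x)))             ≡⟨ regroup x (s + y * (2 + x)) ⟩
  suc (2 + 2 * ((2 + x) + suc (s + y * (2 + x))))       ≤⟨ s≤s bound ⟩
  suc f                                                 ∎
  where
  open ≤-Reasoning
  expand : ∀ s z y x → z * 2 + (2 + y) * 3 + (1 + y + 4 * s + y * x * 2)
                       ≡ 2 * (suc s + z) + (5 + 2 * (s + y * (2 + x)))
  expand = solve-∀
  regroup : ∀ x u → 2 * (2 + x) + (5 + 2 * u) ≡ suc (2 + 2 * ((2 + x) + suc u))
  regroup = solve-∀

-- Subtraction-free form of z - (y + 2)l = e - f, with k = `suc e + w` and f = k + l: the exponents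
-- of 2^z 6^(y+2) and 2^e differ by y + 1 periods f.
negative-exponents : ∀ {e w s y z} l → w ≡ s + y * l → suc s + z ≡ l →
                     z + (suc e + w) * (2 + y) ≡ e + (suc e + w + l) * (1 + y)
negative-exponents {e} {_} {s} {y} {z} _ refl refl = expand e s y z
  where
  expand : ∀ e s y z → z + (suc e + (s + y * (suc s + z))) * (2 + y)
                       ≡ e + (suc e + (s + y * (suc s + z)) + (suc s + z)) * (1 + y)
  expand = solve-∀

-- Arithmetic modulo a prime.

module Modulo (p : ℕ) (isPrime : Prime p) .{{_ : NonZero p}} where

  infix 4 _≈_

  -- A record rather than a synonym, so that Agda can infer a and b from a ≈ b.
  record _≈_ (a b : ℕ) : Set where
    constructor mod
    field residue : a % p ≡ b % p

  open _≈_

  ≈-refl : ∀ {a} → a ≈ a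
  ≈-refl = mod refl

  ≈-sym : ∀ {a b} → a ≈ b → b ≈ a
  ≈-sym (mod e) = mod (sym e)

  ≈-trans : ∀ {a b c} → a ≈ b → b ≈ c → a ≈ c
  ≈-trans (mod e) (mod e′) = mod (trans e e′)

  ≈-reflexive : ∀ {a b} → a ≡ b → a ≈ b
  ≈-reflexive refl = ≈-refl

  ≈-setoid : Setoid _ _
  ≈-setoid = record
    { Carrier = ℕ ; _≈_ = _≈_
    ; isEquivalence = record { refl = ≈-refl ; sym = ≈-sym ; trans = ≈-trans } }

  module ≈-Reasoning = SetoidReasoning ≈-setoid

  _≈?_ : ∀ a b → Dec (a ≈ b)
  a ≈? b = Dec.map′ mod residue (a % p ≟ b % p)

  *-cong : ∀ {a b c d} → a ≈ b → c ≈ d → a * c ≈ b * d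
  *-cong {a} {b} {c} {d} (mod e) (mod e′) = mod (begin
    (a * c) % p              ≡⟨ %-distribˡ-* a c p ⟩
    (a % p * (c % p)) % p    ≡⟨ cong₂ (λ x y → (x * y) % p) e e′ ⟩
    (b % p * (d % p)) % p    ≡⟨ %-distribˡ-* b d p ⟨
    (b * d) % p              ∎)
    where open ≡-Reasoning

  *-congˡ : ∀ {a} c {b} → a ≈ b → c * a ≈ c * b
  *-congˡ c = *-cong (≈-refl {c})

  *-congʳ : ∀ {a} c {b} → a ≈ b → a * c ≈ b * c
  *-congʳ c e = *-cong e (≈-refl {c})

  ^-cong : ∀ {a b} n → a ≈ b → a ^ n ≈ b ^ n
  ^-cong zero    e = ≈-refl
  ^-cong (suc n) e = *-cong e (^-cong n e)

  ≈1⇒^≈1 : ∀ {a} n → a ≈ 1 → a ^ n ≈ 1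
  ≈1⇒^≈1 n e = ≈-trans (^-cong n e) (≈-reflexive (^-zeroˡ n))

  ≈⇒∣∸ : ∀ {a b} → a ≈ b → p ∣ b ∸ a
  ≈⇒∣∸ {a} {b} (mod e) = divides (b / p ∸ a / p) (begin
    b ∸ a                                              ≡⟨ cong₂ _∸_ (m≡m%n+[m/n]*n b p) (m≡m%n+[m/n]*n a p) ⟩
    (b % p + b / p * p) ∸ (a % p + a / p * p)          ≡⟨ cong (λ r → (b % p + b / p * p) ∸ (r + a / p * p)) e ⟩
    (b % p + b / p * p) ∸ (b % p + a / p * p)          ≡⟨ [m+n]∸[m+o]≡n∸o (b % p) _ _ ⟩
    b / p * p ∸ a / p * p                              ≡⟨ *-distribʳ-∸ p (b / p) (a / p) ⟨
    (b / p ∸ a / p) * p                                ∎)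
    where open ≡-Reasoning

  ∣∸⇒≈ : ∀ {a b} → a ≤ b → p ∣ b ∸ a → a ≈ b
  ∣∸⇒≈ {a} {b} a≤b p∣ = mod (begin
    a % p              ≡⟨ %-remove-+ʳ a p∣ ⟨
    (a + (b ∸ a)) % p  ≡⟨ cong (_% p) (m+[n∸m]≡n a≤b) ⟩
    b % p              ∎)
    where open ≡-Reasoning

  <∧<⇒≈⇒≡ : ∀ {a b} → a < p → b < p → a ≈ b → a ≡ b
  <∧<⇒≈⇒≡ a<p b<p (mod e) = trans (sym (m<n⇒m%n≡m a<p)) (trans e (m<n⇒m%n≡m b<p))

  Unit : ℕ → Set
  Unit a = ¬ (p ∣ a)

  unit-resp : ∀ {a b} → a ≈ b → Unit a → Unit b
  unit-resp {a} {b} (mod e) ua p∣b = ua (m%n≡0⇒n∣m a p (trans e (n∣m⇒m%n≡0 b p p∣b)))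

  unit-* : ∀ {a b} → Unit a → Unit b → Unit (a * b)
  unit-* {a} {b} ua ub p∣ab = [ ua , ub ]′ (euclidsLemma a b isPrime p∣ab)

  p>1 : 1 < p
  p>1 = nonTrivial⇒n>1 p {{prime⇒nonTrivial isPrime}}

  unit-1 : Unit 1
  unit-1 p∣1 = <⇒≱ p>1 (∣⇒≤ p∣1)

  unit-^ : ∀ {a} n → Unit a → Unit (a ^ n)
  unit-^ zero    ua = unit-1
  unit-^ (suc n) ua = unit-* ua (unit-^ n ua)

  unit-< : ∀ {a} .{{_ : NonZero a}} → a < p → Unit a
  unit-< a<p p∣a = <⇒≱ a<p (∣⇒≤ p∣a)

  unit-! : ∀ {n} → n < p → Unit (n !)
  unit-! {zero}  _   = unit-1
  unit-! {suc n} n<p = unit-* (unit-< n<p) (unit-! (<-trans (n<1+n n) n<p))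

  -- Euclid's lemma applied to c times a difference. Ordering a and b first makes the truncated
  -- subtraction a true one.
  *-cancelˡ : ∀ {a b} c → Unit c → c * a ≈ c * b → a ≈ b
  *-cancelˡ {a} {b} c uc e with ≤-total a b
  ... | inj₁ a≤b = ∣∸⇒≈ a≤b
    ([ (λ p∣c → contradiction p∣c uc) , (λ p∣ → p∣) ]′
      (euclidsLemma c (b ∸ a) isPrime (subst (p ∣_) (sym (*-distribˡ-∸ c b a)) (≈⇒∣∸ e))))
  ... | inj₂ b≤a = ≈-sym (∣∸⇒≈ b≤a
    ([ (λ p∣c → contradiction p∣c uc) , (λ p∣ → p∣) ]′
      (euclidsLemma c (a ∸ b) isPrime (subst (p ∣_) (sym (*-distribˡ-∸ c a b)) (≈⇒∣∸ (≈-sym e))))))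

  -- Two of the p + 1 powers a^0, ..., a^p share a residue; cancelling the smaller one leaves a
  -- positive power equal to 1.
  finite-order : ∀ {a} → Unit a → ∃ λ n → a ^ suc n ≈ 1
  finite-order {a} ua with pigeonhole (n<1+n p) (λ i → fromℕ< (m%n<n (a ^ toℕ i) p))
  ... | i , j , i<j , eq with m≤n⇒∃[o]m+o≡n i<j
  ...   | n , i+n≡j = n , ≈-sym (*-cancelˡ (a ^ toℕ i) (unit-^ (toℕ i) ua) (begin
    a ^ toℕ i * 1          ≡⟨ *-identityʳ _ ⟩
    a ^ toℕ i              ≈⟨ mod (fromℕ<-injective _ _ _ _ eq) ⟩
    a ^ toℕ j              ≡⟨ cong (a ^_) (trans (sym i+n≡j) (sym (+-suc (toℕ i) n))) ⟩
    a ^ (toℕ i + suc n)    ≡⟨ ^-distribˡ-+-* a (toℕ i) (suc n) ⟩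
    a ^ toℕ i * a ^ suc n  ∎))
    where open ≈-Reasoning

  -- Finite subgroups of the units.

  -- h is the order: elem lists representatives without repetition modulo p.
  record Subgroup (h : ℕ) : Set where
    field
      elem : Fin h → ℕ
      unit : ∀ i → Unit (elem i)
      inj  : ∀ {i j} → elem i ≈ elem j → i ≡ j
      one  : ∃ λ i → elem i ≈ 1
      mul  : ∀ i j → ∃ λ k → elem k ≈ elem i * elem j

  infix 4 _∈_ _∈?_

  _∈_ : ∀ {h} → ℕ → Subgroup h → Set
  a ∈ H = ∃ λ i → Subgroup.elem H i ≈ a

  _∈?_ : ∀ {h} a (H : Subgroup h) → Dec (a ∈ H)
  a ∈? H = any? (λ i → Subgroup.elem H i ≈? a)

  module _ {h} (H : Subgroup h) where
    open Subgroup H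

    ∈-resp : ∀ {a b} → a ≈ b → a ∈ H → b ∈ H
    ∈-resp e (i , eᵢ) = i , ≈-trans eᵢ e

    ∈-unit : ∀ {a} → a ∈ H → Unit a
    ∈-unit (i , eᵢ) = unit-resp eᵢ (unit i)

    ∈-* : ∀ {a b} → a ∈ H → b ∈ H → a * b ∈ H
    ∈-* (i , eᵢ) (j , eⱼ) with mul i j
    ... | k , eₖ = k , ≈-trans eₖ (*-cong eᵢ eⱼ)

    ∈-^ : ∀ {a} n → a ∈ H → a ^ n ∈ H
    ∈-^ zero    a∈ = one
    ∈-^ (suc n) a∈ = ∈-* a∈ (∈-^ n a∈)

    -- Inverses come from finite order: if a^(n+1) ≈ 1, the member a^n undoes the factor a.
    ∈-cancelˡ : ∀ {a b} → a ∈ H → a * b ∈ H → b ∈ H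
    ∈-cancelˡ {a} {b} a∈ ab∈ with finite-order (∈-unit a∈)
    ... | n , aⁿ≈1 = ∈-resp (begin
      a ^ n * (a * b)    ≡⟨ *-assoc (a ^ n) a b ⟨
      a ^ n * a * b      ≡⟨ cong (_* b) (*-comm (a ^ n) a) ⟩
      a ^ suc n * b      ≈⟨ *-congʳ b aⁿ≈1 ⟩
      1 * b              ≡⟨ *-identityˡ b ⟩
      b                  ∎) (∈-* (∈-^ n a∈) ab∈)
      where open ≈-Reasoning

    ∈-! : ∀ n → (∀ k → 1 ≤ k → k ≤ n → k ∈ H) → n ! ∈ H
    ∈-! zero    _   = one
    ∈-! (suc n) all = ∈-* (all (suc n) (s≤s z≤n) ≤-refl) (∈-! n (λ k 1≤k k≤n → all k 1≤k (m≤n⇒m≤1+n k≤n)))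

    distinct-members⇒≤ : ∀ n (g : Fin n → ℕ) → (∀ i → g i ∈ H) →
                         (∀ i j → g i ≈ g j → i ≡ j) → n ≤ h
    distinct-members⇒≤ n g g∈ g-inj with n ≤? h
    ... | yes n≤h = n≤h
    ... | no n≰h with pigeonhole (≰⇒> n≰h) (λ i → proj₁ (g∈ i))
    ...   | i , j , i<j , eq = contradiction (cong toℕ (g-inj i j (begin
      g i                       ≈⟨ proj₂ (g∈ i) ⟨
      elem (proj₁ (g∈ i))       ≡⟨ cong elem eq ⟩
      elem (proj₁ (g∈ j))       ≈⟨ proj₂ (g∈ j) ⟩
      g j                       ∎))) (<⇒≢ i<j)
      where open ≈-Reasoning

    -- The residue 0 is no unit, so listing it with the h elements gives h + 1 distinct residues
    -- among p.
    order<p : h < p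
    order<p with suc h ≤? p
    ... | yes h<p = h<p
    ... | no h≮p with pigeonhole (≰⇒> h≮p) (λ i → fromℕ< (m%n<n (0∷elem i) p))
      where
      0∷elem : Fin (suc h) → ℕ
      0∷elem zero    = 0
      0∷elem (suc i) = elem i
    ...   | zero , suc j , _ , eq = contradiction (p ∣0) (unit-resp (≈-sym (mod (fromℕ<-injective _ _ _ _ eq))) (unit j))
    ...   | suc i , suc j , s≤s i<j , eq = contradiction (cong toℕ (inj (mod (fromℕ<-injective _ _ _ _ eq)))) (<⇒≢ i<j)

  trivial : Subgroup 1
  trivial = record
    { elem = λ _ → 1
    ; unit = λ _ → unit-1
    ; inj  = λ { {zero} {zero} _ → refl }
    ; one  = zero , ≈-refl
    ; mul  = λ _ _ → zero , ≈-refl }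

  -- Adjoining one generator to a subgroup.

  record Extension {h} (H : Subgroup h) (g : ℕ) : Set where
    field
      index-1 : ℕ
      group   : Subgroup (suc index-1 * h)
      power∈  : g ^ suc index-1 ∈ H
      intro   : ∀ n {b} → b ∈ H → g ^ n * b ∈ group
      elim    : ∀ {a} → a ∈ group → ∃₂ λ n b → n ≤ index-1 × b ∈ H × g ^ n * b ≈ a

  opaque
    -- The relative order `suc d` is the least positive exponent taking g into `H`; the finite order
    -- of g bounds the search. The cosets g^i H with i ≤ d are then disjoint and closed under
    -- multiplication.
    extend : ∀ {h} (H : Subgroup h) g → Unit g → Extension H g
    extend {h} H g ug
      with n , gⁿ≈1 ← finite-order ug
      with d , gᵈ∈ , min ← least (λ n → g ^ suc n ∈? H) n (∈-resp H (≈-sym gⁿ≈1) (Subgroup.one H))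
      = record
      { index-1 = d ; group = K ; power∈ = gᵈ∈ ; intro = introᴷ
      ; elim = λ { (k , e) → _ , _ , ≤-pred (toℕ<n (row k)) , (col k , ≈-refl) , e } }
      where
      open Subgroup H

      row : Fin (suc d * h) → Fin (suc d)
      row = proj₁ ∘ remQuot {suc d} h

      col : Fin (suc d * h) → Fin h
      col = proj₂ ∘ remQuot {suc d} h

      elemᴷ : Fin (suc d * h) → ℕ
      elemᴷ k = g ^ toℕ (row k) * elem (col k)

      -- Divide n by `suc d`: the remainder selects the row, and the power of g^(d+1) given by the
      -- quotient is absorbed into b inside `H`.
      introᴷ : ∀ n {b} → b ∈ H → ∃ λ k → elemᴷ k ≈ g ^ n * b
      introᴷ n {b} b∈
        with j , eⱼ ← ∈-* H (∈-^ H (n / suc d) gᵈ∈) b∈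
        = combine i j , (begin
        elemᴷ (combine i j)                                        ≡⟨ cong (λ (i , j) → g ^ toℕ i * elem j) (remQuot-combine i j) ⟩
        g ^ toℕ i * elem j                                         ≡⟨ cong (λ r → g ^ r * elem j) (toℕ-fromℕ< (m%n<n n (suc d))) ⟩
        g ^ (n % suc d) * elem j                                   ≈⟨ *-congˡ (g ^ (n % suc d)) eⱼ ⟩
        g ^ (n % suc d) * ((g ^ suc d) ^ (n / suc d) * b)          ≡⟨ *-assoc (g ^ (n % suc d)) _ b ⟨
        g ^ (n % suc d) * (g ^ suc d) ^ (n / suc d) * b            ≡⟨ cong (λ x → g ^ (n % suc d) * x * b) (^-*-assoc g (suc d) (n / suc d)) ⟩
        g ^ (n % suc d) * g ^ (suc d * (n / suc d)) * b            ≡⟨ cong (_* b) (^-distribˡ-+-* g (n % suc d) _) ⟨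
        g ^ (n % suc d + suc d * (n / suc d)) * b                  ≡⟨ cong (λ x → g ^ (n % suc d + x) * b) (*-comm (suc d) (n / suc d)) ⟩
        g ^ (n % suc d + n / suc d * suc d) * b                    ≡⟨ cong (λ x → g ^ x * b) (m≡m%n+[m/n]*n n (suc d)) ⟨
        g ^ n * b                                                  ∎)
        where
        open ≈-Reasoning
        i : Fin (suc d)
        i = fromℕ< (m%n<n n (suc d))

      -- Cancelling g^m puts g^(m′-m) in `H`, with 0 < m′ - m ≤ d, against the minimality of
      -- `suc d`.
      row-≮ : ∀ {m m′} j j′ → m′ ≤ d → g ^ m * elem j ≈ g ^ m′ * elem j′ → ¬ (m < m′)
      row-≮ {m} {m′} j j′ m′≤d e m<m′ with m≤n⇒∃[o]m+o≡n m<m′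
      ... | o , refl = min o (≤-trans (s≤s (m≤n+m o m)) m′≤d)
        (∈-cancelˡ H (j′ , ≈-refl) (j , *-cancelˡ (g ^ m) (unit-^ m ug) (begin
          g ^ m * elem j                     ≈⟨ e ⟩
          g ^ suc (m + o) * elem j′          ≡⟨ cong (λ x → g ^ x * elem j′) (+-suc m o) ⟨
          g ^ (m + suc o) * elem j′          ≡⟨ cong (_* elem j′) (^-distribˡ-+-* g m (suc o)) ⟩
          g ^ m * g ^ suc o * elem j′        ≡⟨ *-assoc (g ^ m) _ _ ⟩
          g ^ m * (g ^ suc o * elem j′)      ≡⟨ cong (g ^ m *_) (*-comm (g ^ suc o) (elem j′)) ⟩
          g ^ m * (elem j′ * g ^ suc o)      ∎)))
        where open ≈-Reasoning

      injᴷ : ∀ {k k′} → elemᴷ k ≈ elemᴷ k′ → k ≡ k′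
      injᴷ {k} {k′} e = begin
        k                              ≡⟨ combine-remQuot {suc d} h k ⟨
        combine (row k) (col k)        ≡⟨ cong₂ combine rows cols ⟩
        combine (row k′) (col k′)      ≡⟨ combine-remQuot {suc d} h k′ ⟩
        k′                             ∎
        where
        open ≡-Reasoning
        rows : row k ≡ row k′
        rows with <-cmp (toℕ (row k)) (toℕ (row k′))
        ... | tri< lt _ _ = contradiction lt (row-≮ (col k) (col k′) (≤-pred (toℕ<n (row k′))) e)
        ... | tri≈ _ eq _ = toℕ-injective eq
        ... | tri> _ _ gt = contradiction gt (row-≮ (col k′) (col k) (≤-pred (toℕ<n (row k))) (≈-sym e))
        cols : col k ≡ col k′
        cols = inj (*-cancelˡ (g ^ toℕ (row k)) (unit-^ (toℕ (row k)) ug)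
          (≈-trans e (≈-reflexive (cong (λ i → g ^ toℕ i * elem (col k′)) (sym rows)))))

      K : Subgroup (suc d * h)
      K = record
        { elem = elemᴷ
        ; unit = λ k → unit-* (unit-^ (toℕ (row k)) ug) (unit (col k))
        ; inj  = injᴷ
        ; one  = introᴷ 0 one
        ; mul  = λ k k′ →
            let a = toℕ (row k) ; b = toℕ (row k′) ; x = elem (col k) ; y = elem (col k′)
                i , e = introᴷ (a + b) (∈-* H (col k , ≈-refl) (col k′ , ≈-refl))
            in i , ≈-trans e (≈-reflexive (trans (cong (_* (x * y)) (^-distribˡ-+-* g a b))
                                                 (interchange (g ^ a) (g ^ b) x y)))
        }
        where
        interchange : ∀ a b x y → a * b * (x * y) ≡ a * x * (b * y)
        interchange = solve-∀

  module _ {h} {H : Subgroup h} {g} (E : Extension H g) where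
    open Extension E

    base⊆extension : ∀ {b} → b ∈ H → b ∈ group
    base⊆extension {b} b∈ = ∈-resp group (≈-reflexive (*-identityˡ b)) (intro 0 b∈)

    generator∈extension : g ∈ group
    generator∈extension = ∈-resp group (≈-reflexive (trans (*-identityʳ (g ^ 1)) (*-identityʳ g))) (intro 1 (Subgroup.one H))

  -- Residues obtained from factorial products of a given cost.

  Reach : ℕ → ℕ → Set
  Reach c a = ∃ λ xs → All (1 ≤_) xs × sum xs ≡ c × factProd xs ≈ a

  -- For explicit lists: positivity of the parts and the congruence are both settled by evaluating
  -- their decision procedures.
  reach-parts : ∀ xs {a} {_ : True (all? (1 ≤?_) xs)} {_ : True (factProd xs ≈? a)} → Reach (sum xs) a
  reach-parts xs {_} {pos} {e} = xs , toWitness pos , refl , toWitness e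

  reach-resp : ∀ {c a b} → a ≈ b → Reach c a → Reach c b
  reach-resp e (xs , pos , sm , eq) = xs , pos , sm , ≈-trans eq e

  reach-* : ∀ {c d a b} → Reach c a → Reach d b → Reach (c + d) (a * b)
  reach-* (xs , pos , sm , eq) (ys , pos′ , sm′ , eq′) =
    xs ++ ys , ++⁺ pos pos′ , trans (sum-++ xs ys) (cong₂ _+_ sm sm′) ,
    ≈-trans (≈-reflexive (trans (cong product (map-++ _! xs ys)) (product-++ (map _! xs) (map _! ys)))) (*-cong eq eq′)

  reach-! : ∀ n → 1 ≤ n → Reach n (n !)
  reach-! n 1≤n = n ∷ [] , 1≤n ∷ [] , +-identityʳ n , ≈-reflexive (*-identityʳ (n !))

  reach-^ : ∀ {c a} n → Reach c a → Reach (n * c) (a ^ n)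
  reach-^ zero    r = [] , [] , refl , ≈-refl
  reach-^ (suc n) r = reach-* r (reach-^ n r)

  reach-mono : ∀ {c d a} → c ≤ d → Reach c a → Reach d a
  reach-mono {c} {d} {a} c≤d r with m≤n⇒∃[o]m+o≡n c≤d
  ... | o , refl = reach-resp (≈-reflexive (trans (cong (a *_) (^-zeroˡ o)) (*-identityʳ a)))
    (subst (λ k → Reach (c + k) (a * 1 ^ o)) (*-identityʳ o) (reach-* r (reach-^ o (reach-! 1 ≤-refl))))

  -- Products of powers of 2 and 6.

  reach-2^*6^ : ∀ i j → Reach (i * 2 + j * 3) (2 ^ i * 6 ^ j)
  reach-2^*6^ i j = reach-* (reach-^ i (reach-! 2 (s≤s z≤n))) (reach-^ j (reach-! 3 (s≤s z≤n)))

  -- The cyclic case, where 6 is itself a power of 2. Large exponents are shortened by trading k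
  -- factors 2, of cost 2k, for a single 3! of cost 3.
  reach-power-of-2 : ∀ {f k} → 2 ^ f ≈ 1 → 2 ^ k ≈ 6 → 3 ≤ k → k < f → ¬ (1 ≈ 12) →
                     ∀ e → e < f → Reach (suc f) (2 ^ e)
  reach-power-of-2 {f} {k} 2ᶠ≈1 2ᵏ≈6 3≤k k<f 1≉12 e e<f with e * 2 ≤? suc f
  ... | yes 2e≤ = reach-mono 2e≤ (reach-^ e (reach-! 2 (s≤s z≤n)))
  ... | no 2e≰ with k ≤? e
  ...   | yes k≤e with m≤n⇒∃[o]m+o≡n k≤e
  -- Here e = k + o, and dividing o by k gives 2^e = 2^r 6^(c+1).
  ...     | o , refl = reach-mono cost (reach-resp value (reach-2^*6^ r (suc c)))
    where
    instance
      k≢0 : NonZero k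
      k≢0 = ℕ.>-nonZero (≤-trans (s≤s z≤n) 3≤k)
    r = o % k
    c = o / k
    o≡ : o ≡ r + c * k
    o≡ = m≡m%n+[m/n]*n o k
    cost : r * 2 + suc c * 3 ≤ suc f
    cost = ≤-trans (positive-exponent-cost r c k 3≤k (m%n<n o k))
                   (≤-trans (≤-reflexive (cong (λ x → 2 + (k + x)) (sym o≡))) (s≤s e<f))
    exponents : ∀ r c k → r + k * suc c ≡ k + (r + c * k)
    exponents = solve-∀
    open ≈-Reasoning
    value : 2 ^ r * 6 ^ suc c ≈ 2 ^ (k + o)
    value = begin
      2 ^ r * 6 ^ suc c          ≈⟨ *-congˡ (2 ^ r) (^-cong (suc c) 2ᵏ≈6) ⟨
      2 ^ r * (2 ^ k) ^ suc c    ≡⟨ cong (2 ^ r *_) (^-*-assoc 2 k (suc c)) ⟩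
      2 ^ r * 2 ^ (k * suc c)    ≡⟨ ^-distribˡ-+-* 2 r (k * suc c) ⟨
      2 ^ (r + k * suc c)        ≡⟨ cong (2 ^_) (exponents r c k) ⟩
      2 ^ (k + (r + c * k))      ≡⟨ cong (λ x → 2 ^ (k + x)) o≡ ⟨
      2 ^ (k + o)                ∎
  reach-power-of-2 {f} {k} 2ᶠ≈1 2ᵏ≈6 3≤k k<f 1≉12 e e<f | no 2e≰ | no k≰e
    with m≤n⇒∃[o]m+o≡n k<f | m≤n⇒∃[o]m+o≡n (≰⇒> k≰e)
  -- Here f = k + 1, so 1 = 2^f = 2 · 6 = 12, which is excluded.
  ... | zero , refl | _ = contradiction (begin
      1              ≈⟨ 2ᶠ≈1 ⟨
      2 * 2 ^ (k + 0) ≡⟨ cong (λ x → 2 * 2 ^ x) (+-identityʳ k) ⟩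
      2 * 2 ^ k      ≈⟨ *-congˡ 2 2ᵏ≈6 ⟩
      12             ∎) 1≉12
    where open ≈-Reasoning
  -- Now l = f - k is at least 2 and w = k - e - 1, so f - e = l + 1 + w. With s and y the remainder
  -- and quotient of w by l, the least multiple of l not below f - e is (y + 2)l, and z = l - 1 - s
  -- is the gap.
  ... | suc x , refl | w , refl with m≤n⇒∃[o]m+o≡n (m%n<n w (2 + x))
  ...   | z , s+z≡l = reach-mono (negative-exponent-cost s z y l (s≤s (s≤s z≤n)) s+z≡l bound)
                                 (reach-resp value (reach-2^*6^ z (2 + y)))
    where
    l = 2 + x
    s = w % l
    y = w / l
    w≡ : w ≡ s + y * l
    w≡ = m≡m%n+[m/n]*n w l
    f≡ : ∀ e w x → suc (suc e + w) + suc x ≡ e + (2 + x + suc w)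
    f≡ = solve-∀
    f≡k+l : ∀ k x → suc k + suc x ≡ k + (2 + x)
    f≡k+l = solve-∀
    -- `l + suc w` is f - e. The failure of 2e ≤ f + 1 means f + 2 ≤ 2e, hence f - e ≤ e - 2.
    codegree-small : 2 + (l + suc w) ≤ e
    codegree-small = +-cancelˡ-≤ e _ _ (begin
      e + (2 + (l + suc w))    ≡⟨ shift e (l + suc w) ⟩
      2 + (e + (l + suc w))    ≡⟨ cong (2 +_) (f≡ e w x) ⟨
      2 + f                    ≤⟨ ≰⇒> 2e≰ ⟩
      e * 2                    ≡⟨ double e ⟩
      e + e                    ∎)
      where
      open ≤-Reasoning
      shift : ∀ e u → e + (2 + u) ≡ 2 + (e + u)
      shift = solve-∀
      double : ∀ e → e * 2 ≡ e + e
      double = solve-∀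
    bound : 2 + 2 * (l + suc (s + y * l)) ≤ f
    bound = begin
      2 + 2 * (l + suc (s + y * l))      ≡⟨ cong (λ u → 2 + 2 * (l + suc u)) w≡ ⟨
      2 + 2 * (l + suc w)                ≡⟨ split (l + suc w) ⟩
      2 + (l + suc w) + (l + suc w)      ≤⟨ +-monoˡ-≤ (l + suc w) codegree-small ⟩
      e + (l + suc w)                    ≡⟨ f≡ e w x ⟨
      f                                  ∎
      where
      open ≤-Reasoning
      split : ∀ u → 2 + 2 * u ≡ 2 + u + u
      split = solve-∀
    exponents : z + k * (2 + y) ≡ e + f * (1 + y)
    exponents = trans (negative-exponents l w≡ s+z≡l) (cong (λ u → e + u * (1 + y)) (sym (f≡k+l k x)))
    open ≈-Reasoning
    value : 2 ^ z * 6 ^ (2 + y) ≈ 2 ^ e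
    value = begin
      2 ^ z * 6 ^ (2 + y)            ≈⟨ *-congˡ (2 ^ z) (^-cong (2 + y) 2ᵏ≈6) ⟨
      2 ^ z * (2 ^ k) ^ (2 + y)      ≡⟨ cong (2 ^ z *_) (^-*-assoc 2 k (2 + y)) ⟩
      2 ^ z * 2 ^ (k * (2 + y))      ≡⟨ ^-distribˡ-+-* 2 z (k * (2 + y)) ⟨
      2 ^ (z + k * (2 + y))          ≡⟨ cong (2 ^_) exponents ⟩
      2 ^ (e + f * (1 + y))          ≡⟨ ^-distribˡ-+-* 2 e (f * (1 + y)) ⟩
      2 ^ e * 2 ^ (f * (1 + y))      ≡⟨ cong (2 ^ e *_) (^-*-assoc 2 f (1 + y)) ⟨
      2 ^ e * (2 ^ f) ^ (1 + y)      ≈⟨ *-congˡ (2 ^ e) (≈1⇒^≈1 (1 + y) 2ᶠ≈1) ⟩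
      2 ^ e * 1                      ≡⟨ *-identityʳ _ ⟩
      2 ^ e                          ∎

  -- The invariant of the induction on n. The subgroup is existential because it may stay or grow at
  -- each step; the budget always exceeds its order by one.
  Covers : ℕ → Set
  Covers n = ∃₂ λ h (H : Subgroup h) →
    (∀ k → 1 ≤ k → k ≤ n → k ∈ H) × (∀ {a} → a ∈ H → Reach (suc h) a)

  -- Excluding 2 and 3 makes both generators units and the order of 2 at least 3. Excluding 5 rules
  -- out 6 ≈ 2^0, and excluding 11 rules out 12 ≈ 1.
  covers-3 : p ≢ 2 → p ≢ 3 → p ≢ 5 → p ≢ 11 → Covers 3
  covers-3 p≢2 p≢3 p≢5 p≢11 = _ , ⟨2,6⟩ , small , reach
    where
    p∤ : ∀ q {_ : True (prime? q)} → p ≢ q → Unit q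
    p∤ q {pq} p≢q p∣q = p≢q (prime∣prime⇒≡ isPrime (toWitness pq) p∣q)

    unit-2 = p∤ 2 p≢2
    unit-3 = p∤ 3 p≢3

    E₂ = extend trivial 2 unit-2
    ⟨2⟩ = Extension.group E₂
    f-1 = Extension.index-1 E₂
    E₆ = extend ⟨2⟩ 6 (unit-* unit-2 unit-3)
    ⟨2,6⟩ = Extension.group E₆
    d-1 = Extension.index-1 E₆

    2ᶠ≈1 : 2 ^ suc f-1 ≈ 1
    2ᶠ≈1 = ≈-sym (proj₂ (Extension.power∈ E₂))

    f≥3 : ∀ f-1 → 2 ^ suc f-1 ≈ 1 → 3 ≤ suc f-1
    f≥3 0 e = contradiction (≈⇒∣∸ (≈-sym e)) unit-1
    f≥3 1 e = contradiction (≈⇒∣∸ (≈-sym e)) unit-3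
    f≥3 (suc (suc _)) _ = s≤s (s≤s (s≤s z≤n))

    -- Exponents 0, 1, 2 would make p divide 6 - 1, 6 - 2, 6 - 4 respectively.
    k≥3 : ∀ k → 2 ^ k ≈ 6 → 3 ≤ k
    k≥3 0 e = contradiction (≈⇒∣∸ e) (p∤ 5 p≢5)
    k≥3 1 e = contradiction (≈⇒∣∸ e) (unit-* unit-2 unit-2)
    k≥3 2 e = contradiction (≈⇒∣∸ e) unit-2
    k≥3 (suc (suc (suc _))) _ = s≤s (s≤s (s≤s z≤n))

    2∈ : 2 ∈ ⟨2,6⟩
    2∈ = base⊆extension E₆ (generator∈extension E₂)

    small : ∀ k → 1 ≤ k → k ≤ 3 → k ∈ ⟨2,6⟩
    small 1 _ _ = Subgroup.one ⟨2,6⟩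
    small 2 _ _ = 2∈
    small 3 _ _ = ∈-cancelˡ ⟨2,6⟩ 2∈ (generator∈extension E₆)
    small (suc (suc (suc (suc _)))) _ (s≤s (s≤s (s≤s ())))

    ⟨2⟩-elim : ∀ {b} → b ∈ ⟨2⟩ → ∃ λ i → i ≤ f-1 × 2 ^ i ≈ b
    ⟨2⟩-elim b∈ with Extension.elim E₂ b∈
    ... | i , c , i≤ , (_ , 1≈c) , e =
      i , i≤ , ≈-trans (≈-trans (≈-reflexive (sym (*-identityʳ (2 ^ i)))) (*-congˡ (2 ^ i) 1≈c)) e

    order≡ : ∀ d f → suc d * (suc f * 1) ≡ suc d * suc f
    order≡ d f = cong (suc d *_) (*-identityʳ (suc f))

    reach-cyclic : 6 ^ 1 ∈ ⟨2⟩ → ∀ {b} → b ∈ ⟨2⟩ → Reach (suc (suc f-1)) b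
    reach-cyclic 6∈ b∈ with ⟨2⟩-elim 6∈ | ⟨2⟩-elim b∈
    ... | k , k≤ , 2ᵏ≈6 | i , i≤ , e =
      reach-resp e (reach-power-of-2 2ᶠ≈1 2ᵏ≈6 (k≥3 k 2ᵏ≈6) (s≤s k≤) (p∤ 11 p≢11 ∘ ≈⇒∣∸) i (s≤s i≤))

    -- Relative index 1 means that 6 is a power of 2, so the cyclic bound applies; from index 2 on,
    -- the normal form 2^i 6^j is already cheap enough. The factor `* 1` is the order of `trivial`.
    reach-coset : ∀ d {j a b} → 6 ^ suc d ∈ ⟨2⟩ → j ≤ d → b ∈ ⟨2⟩ → 6 ^ j * b ≈ a →
                  Reach (suc (suc d * (suc f-1 * 1))) a
    reach-coset zero {b = b} 6∈ z≤n b∈ e =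
      reach-mono (s≤s (≤-reflexive (sym (trans (order≡ 0 f-1) (*-identityˡ (suc f-1))))))
        (reach-resp (≈-trans (≈-reflexive (sym (*-identityˡ b))) e) (reach-cyclic 6∈ b∈))
    reach-coset (suc d) {j} _ j≤ b∈ e with ⟨2⟩-elim b∈
    ... | i , i≤ , e′ =
      reach-mono (≤-trans (two-generator-cost (f≥3 f-1 2ᶠ≈1) (s≤s (s≤s z≤n)) i≤ j≤)
                          (s≤s (≤-reflexive (sym (order≡ (suc d) f-1)))))
        (reach-resp (≈-trans (≈-trans (≈-reflexive (*-comm (2 ^ i) (6 ^ j))) (*-congˡ (6 ^ j) e′)) e)
                    (reach-2^*6^ i j))

    reach : ∀ {a} → a ∈ ⟨2,6⟩ → Reach (suc (suc d-1 * (suc f-1 * 1))) a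
    reach a∈ =
      let j , b , j≤ , b∈ , e = Extension.elim E₆ a∈
      in reach-coset d-1 (Extension.power∈ E₆) j≤ b∈ e

  -- Enlarging the covered segment by adjoining factorials.

  -- Otherwise 2n = p + o, so 2(n + 1) ≈ o + 2. Since n + 2 ≤ p, also o + 2 ≤ n; thus o + 2 is in
  -- `H`, and cancelling 2 would put n + 1 in `H`.
  nonmember⇒2n<p : ∀ {h n} (H : Subgroup h) → 2 ≤ n → suc n < p →
                    (∀ k → 1 ≤ k → k ≤ n → k ∈ H) → ¬ (suc n ∈ H) → 2 * n < p
  nonmember⇒2n<p {h} {n} H 2≤n n+1<p small n+1∉ with suc (2 * n) ≤? p
  ... | yes 2n<p = 2n<p
  ... | no 2n≮p with m≤n⇒∃[o]m+o≡n (≤-pred (≰⇒> 2n≮p))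
  ...   | o , p+o≡2n = contradiction
    (∈-cancelˡ H (small 2 (s≤s z≤n) 2≤n) (∈-resp H (≈-sym 2[n+1]≈o+2) (small (2 + o) (s≤s z≤n) o+2≤n))) n+1∉
    where
    2[n+1] : ∀ n → 2 * suc n ≡ 2 + 2 * n
    2[n+1] = solve-∀
    shift : ∀ p o → 2 + (p + o) ≡ 2 + o + p
    shift = solve-∀
    2[n+1]≈o+2 : 2 * suc n ≈ 2 + o
    2[n+1]≈o+2 = mod (trans
      (cong (_% p) (trans (2[n+1] n) (trans (cong (2 +_) (sym p+o≡2n)) (shift p o))))
      ([m+n]%n≡m%n (2 + o) p))
    o+2≤n : 2 + o ≤ n
    o+2≤n = +-cancelˡ-≤ n _ _ (begin
      n + (2 + o)      ≡⟨ move n o ⟩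
      (2 + n) + o      ≤⟨ +-monoˡ-≤ o n+1<p ⟩
      p + o            ≡⟨ p+o≡2n ⟩
      2 * n            ≡⟨ cong (n +_) (+-identityʳ n) ⟩
      n + n            ∎)
      where
      open ≤-Reasoning
      move : ∀ n o → n + (2 + o) ≡ (2 + n) + o
      move = solve-∀

  -- The integers 1, ..., n and 2n all lie below p, so being distinct they are distinct modulo p.
  -- The extra member 2n raises the count to n + 1, the cost of the factorial to be adjoined.
  nonmember⇒≤order : ∀ {h n} (H : Subgroup h) → 2 ≤ n → suc n < p →
                      (∀ k → 1 ≤ k → k ≤ n → k ∈ H) → ¬ (suc n ∈ H) → suc n ≤ h
  nonmember⇒≤order {h} {n} H 2≤n n+1<p small n+1∉ =
    distinct-members⇒≤ H (suc n) g g∈ λ i j e → g-inj i j (<∧<⇒≈⇒≡ (g<p i) (g<p j) e)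
    where
    2n<p = nonmember⇒2n<p H 2≤n n+1<p small n+1∉
    n<2n : n < 2 * n
    n<2n = m<m+n n (≤-trans (s≤s z≤n) (≤-trans 2≤n (m≤m+n n 0)))

    g : Fin (suc n) → ℕ
    g zero    = 2 * n
    g (suc i) = suc (toℕ i)

    g∈ : ∀ i → g i ∈ H
    g∈ zero    = ∈-* H (small 2 (s≤s z≤n) 2≤n) (small n (≤-trans (s≤s z≤n) 2≤n) ≤-refl)
    g∈ (suc i) = small (suc (toℕ i)) (s≤s z≤n) (toℕ<n i)

    g<p : ∀ i → g i < p
    g<p zero    = 2n<p
    g<p (suc i) = ≤-<-trans (toℕ<n i) (<-trans (n<1+n n) n+1<p)

    g-inj : ∀ i j → g i ≡ g j → i ≡ j
    g-inj zero    zero    _  = refl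
    g-inj zero    (suc j) eq = contradiction (sym eq) (<⇒≢ (≤-<-trans (toℕ<n j) n<2n))
    g-inj (suc i) zero    eq = contradiction eq (<⇒≢ (≤-<-trans (toℕ<n i) n<2n))
    g-inj (suc i) (suc j) eq = cong suc (toℕ-injective (suc-injective eq))

  -- The generator is (n + 1)! because a single part n + 1 pays for it; n + 1 itself follows by
  -- cancelling n!, a product of members. Each further power costs n + 1 ≤ h, while each further
  -- coset adds h to the budget.
  covers-suc : ∀ {n} → 2 ≤ n → suc n < p → Covers n → Covers (suc n)
  covers-suc {n} 2≤n n+1<p (h , H , small , reach) with suc n ∈? H
  ... | yes n+1∈ = h , H , ≤suc-elim small n+1∈ , reach
  ... | no n+1∉ = _ , K , ≤suc-elim smallᴷ n+1∈K , reachᴷ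
    where
    E = extend H (suc n !) (unit-! n+1<p)
    K = Extension.group E
    d-1 = Extension.index-1 E

    smallᴷ : ∀ k → 1 ≤ k → k ≤ n → k ∈ K
    smallᴷ k 1≤k k≤n = base⊆extension E (small k 1≤k k≤n)

    n+1∈K : suc n ∈ K
    n+1∈K = ∈-cancelˡ K (∈-! K n smallᴷ)
      (∈-resp K (≈-reflexive (*-comm (suc n) (n !))) (generator∈extension E))

    reachᴷ : ∀ {a} → a ∈ K → Reach (suc (suc d-1 * h)) a
    reachᴷ a∈ with Extension.elim E a∈
    ... | j , b , j≤ , b∈ , e =
      reach-mono cost (reach-resp e (reach-* (reach-^ j (reach-! (suc n) (s≤s z≤n))) (reach b∈)))
      where
      open ≤-Reasoning
      cost : j * suc n + suc h ≤ suc (suc d-1 * h)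
      cost = begin
        j * suc n + suc h    ≤⟨ +-monoˡ-≤ (suc h) (*-mono-≤ j≤ (nonmember⇒≤order H 2≤n n+1<p small n+1∉)) ⟩
        d-1 * h + suc h      ≡⟨ +-comm (d-1 * h) (suc h) ⟩
        suc (h + d-1 * h)    ∎

  -- All nonzero residues, and the passage to compositions of p.

  covers : Covers 3 → ∀ j → 3 + j < p → Covers (3 + j)
  covers c zero    _  = c
  covers c (suc j) lt = covers-suc (s≤s (s≤s z≤n)) lt (covers c j (<-trans (n<1+n _) lt))

  -- The induction runs up to the larger of m and 3. As h < p, the budget h + 1 is at most p, and
  -- parts equal to 1 fill the sum up to p.
  reach-all : Covers 3 → ∀ m → 1 ≤ m → m < p → Reach p m
  reach-all c₃ m 1≤m m<p with covers-m
    where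
    covers-m : ∃ λ n → m ≤ n × Covers n
    covers-m with 3 ≤? m
    ... | no 3≰m = 3 , ≤-trans (n≤1+n m) (≰⇒> 3≰m) , c₃
    ... | yes 3≤m with m≤n⇒∃[o]m+o≡n 3≤m
    ...   | j , refl = m , ≤-refl , covers c₃ j m<p
  ... | n , m≤n , h , H , small , reach = reach-mono (order<p H) (reach (small m 1≤m m≤n))

  -- Two parts are forced: the empty list has sum 0, and a single part would be p, with p! ≈ 0
  -- although m is a unit.
  reach⇒composition : ∀ {m} → 1 ≤ m → m < p → Reach p m →
    Σ ℕ (λ t → 2 ≤ t × Σ (List ℕ) (λ xs → IsComposition p t xs × factProd xs % p ≡ m))
  reach⇒composition 1≤m m<p ([] , _ , refl , _) = contradiction p>1 λ ()
  reach⇒composition {m} 1≤m m<p (x ∷ [] , _ , x+0≡p , e) = contradiction p∣m (unit-< {{ℕ.>-nonZero 1≤m}} m<p)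
    where
    n∣n! : ∀ n .{{_ : NonZero n}} → n ∣ n !
    n∣n! (suc n) = m∣m*n (n !)
    p∣p! : p ∣ x ! * 1
    p∣p! = subst (p ∣_) (trans (cong _! (trans (sym x+0≡p) (+-identityʳ x))) (sym (*-identityʳ (x !)))) (n∣n! p)
    p∣m : p ∣ m
    p∣m = m%n≡0⇒n∣m m p (trans (sym (residue e)) (n∣m⇒m%n≡0 _ p p∣p!))
  reach⇒composition 1≤m m<p (xs@(_ ∷ _ ∷ _) , pos , sm , mod e) =
    length xs , s≤s (s≤s z≤n) , xs , (refl , pos , sm) , trans e (m<n⇒m%n≡m m<p)

theorem2 : (p : ℕ) → Prime p → p ≢ 5 → .{{_ : NonZero p}} →
    (m : ℕ) → 1 ≤ m → m < p →
    Σ ℕ (λ t → 2 ≤ t × Σ (List ℕ) (λ xs → IsComposition p t xs × factProd xs % p ≡ m))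
theorem2 p isPrime p≢5 m 1≤m m<p with p ≟ 2 | p ≟ 3 | p ≟ 11
... | no p≢2 | no p≢3 | no p≢11 =
  reach⇒composition 1≤m m<p (reach-all (covers-3 p≢2 p≢3 p≢5 p≢11) m 1≤m m<p)
  where open Modulo p isPrime
-- For 2 and 3 the generator 6 is not a unit, so explicit lists are given.
... | yes refl | _ | _ = reach⇒composition 1≤m m<p (table m 1≤m m<p)
  where
  open Modulo 2 isPrime
  table : ∀ m → 1 ≤ m → m < 2 → Reach 2 m
  table 1 _ _ = reach-parts (1 ∷ 1 ∷ [])
  table (suc (suc _)) _ (s≤s (s≤s ()))
... | no _ | yes refl | _ = reach⇒composition 1≤m m<p (table m 1≤m m<p)
  where
  open Modulo 3 isPrime
  table : ∀ m → 1 ≤ m → m < 3 → Reach 3 m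
  table 1 _ _ = reach-parts (1 ∷ 1 ∷ 1 ∷ [])
  table 2 _ _ = reach-parts (2 ∷ 1 ∷ [])
  table (suc (suc (suc _))) _ (s≤s (s≤s (s≤s ())))
-- Modulo 11 the residue 6 is the inverse of 2, the case l = 1 that the cyclic argument excludes;
-- explicit lists of sum 11 replace it.
... | no _ | no _ | yes refl = reach⇒composition 1≤m m<p (table m 1≤m m<p)
  where
  open Modulo 11 isPrime
  table : ∀ m → 1 ≤ m → m < 11 → Reach 11 m
  table 1 _ _ = reach-parts (5 ∷ 5 ∷ 1 ∷ [])
  table 2 _ _ = reach-parts (9 ∷ 2 ∷ [])
  table 3 _ _ = reach-parts (3 ∷ 3 ∷ 3 ∷ 2 ∷ [])
  table 4 _ _ = reach-parts (7 ∷ 4 ∷ [])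
  table 5 _ _ = reach-parts (6 ∷ 3 ∷ 2 ∷ [])
  table 6 _ _ = reach-parts (6 ∷ 5 ∷ [])
  table 7 _ _ = reach-parts (5 ∷ 4 ∷ 2 ∷ [])
  table 8 _ _ = reach-parts (8 ∷ 3 ∷ [])
  table 9 _ _ = reach-parts (5 ∷ 4 ∷ 1 ∷ 1 ∷ [])
  table 10 _ _ = reach-parts (10 ∷ 1 ∷ [])
  table (suc (suc (suc (suc (suc (suc (suc (suc (suc (suc (suc m))))))))))) _ lt =
    contradiction lt (≤⇒≯ (m≤m+n 11 m))
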